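{- Let $(X,\mathcal{A})$ be a $(v,k,\lambda)$-BIBD. Then there exists a harmonious colouring of the Levi graph $\mathcal{L}(X,\mathcal{A})$ using $w$ colours if and only if there is a strong nesting $\phi:\mathcal{A}\to Y$ of $(X,\mathcal{A})$ with $X\subseteq Y$ and $|Y|=w$.
   Context: A $(v,k,\lambda)$-BIBD is a pair $(X,\mathcal{A})$ where $X$ is a set of $v$ points and $\mathcal{A}$ is a multiset of $k$-subsets of $X$ (blocks) such that every pair of distinct points lies in exactly $\lambda$ blocks. Given such $(X,\mathcal{A})$ and a set $Y\supseteq X$ with $|Y|=w$, a map $\phi:\mathcal{A}\to Y$ is a strong nesting if (1) $\phi(A)\notin A$ for every block $A\in\mathcal{A}$, and (2) the multiset of pairs $\{\{x,\phi(A)\}: A\in\mathcal{A},\ x\in A\}$ consists of distinct pairs. The Levi graph $\mathcal{L}(X,\mathcal{A})$ is the bipartite graph with vertex set $X\cup\mathcal{A}$ (each block of the multiset a separate vertex) and an edge $\{x,A\}$ whenever $x\in A$. A harmonious colouring of a graph is a map $c$ from its vertices to a set of colours such that adjacent vertices receive different colours and no two distinct edges $\{u,u'\}$, $\{z,z'\}$ satisfy $\{c(u),c(u')\}=\{c(z),c(z')\}$. -}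

module Defs where

open import Data.Fin using (Fin)
open import Data.Fin.Subset using (Subset; _∈_; ∣_∣)
open import Data.Fin.Subset.Properties using (_∈?_)
open import Data.List using (List; length; filter; lookup)
open import Data.Nat using (ℕ; _>_)
open import Data.Product using (Σ-syntax; _×_; _,_)
open import Data.Sum using (_⊎_; inj₁; inj₂)
open import Function.Bundles using (_↣_; _↔_; Injection)
open import Relation.Binary using (Rel; Symmetric; Irreflexive)
open import Relation.Binary.PropositionalEquality using (_≡_; _≢_; refl)
open import Relation.Nullary using (¬_)
open import Relation.Nullary.Decidable using (_×-dec_)
open import Level using (0ℓ)

-- Equality { a , b } = { c , d } of unordered pairs.
SamePair : {A : Set} → A → A → A → A → Set
SamePair a b c d = (a ≡ c × b ≡ d) ⊎ (a ≡ d × b ≡ c)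

record Graph : Set₁ where
  field
    Vertex : Set
    Adj    : Rel Vertex 0ℓ
    sym    : Symmetric Adj
    irrefl : Irreflexive _≡_ Adj

-- An edge { u , u′ } is presented by an adjacent ordered pair of vertices;
-- two such presentations are the same edge exactly when SamePair holds.
record IsHarmonious (G : Graph) {C : Set} (c : Graph.Vertex G → C) : Set where
  open Graph G
  field
    proper   : ∀ {u u′} → Adj u u′ → c u ≢ c u′
    distinct : ∀ {u u′ z z′} → Adj u u′ → Adj z z′ →
               ¬ SamePair u u′ z z′ →
               ¬ SamePair (c u) (c u′) (c z) (c z′)

-- The colours come from a set of size w; not all of them need to occur.
HarmoniousColouring : Graph → ℕ → Set
HarmoniousColouring G w = Σ[ c ∈ (Graph.Vertex G → Fin w) ] IsHarmonious G c

-- The point set is Fin v.  The multiset of blocks is a list, so that a block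
-- counted with multiplicity is a position in the list.  As usual for BIBDs,
-- the index (the third parameter, "lambda") is positive; with index 0 a design
-- may have no blocks at all, and its points could then share a colour.
record BIBD (v k index : ℕ) : Set where
  field
    blocks    : List (Subset v)
    index>0   : index > 0
    blockSize : ∀ i → ∣ lookup blocks i ∣ ≡ k
    balanced  : ∀ (x y : Fin v) → x ≢ y →
                length (filter (λ S → (x ∈? S) ×-dec (y ∈? S)) blocks) ≡ index

  Point Block : Set
  Point = Fin v
  Block = Fin (length blocks)

  ⟦_⟧ : Block → Subset v
  ⟦ A ⟧ = lookup blocks A

module _ {v k index : ℕ} (D : BIBD v k index) where
  open BIBD D

  data LeviAdj : Rel (Point ⊎ Block) 0ℓ where
    point-block : ∀ {x A} → x ∈ ⟦ A ⟧ → LeviAdj (inj₁ x) (inj₂ A)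
    block-point : ∀ {x A} → x ∈ ⟦ A ⟧ → LeviAdj (inj₂ A) (inj₁ x)

  leviGraph : Graph
  leviGraph = record
    { Vertex = Point ⊎ Block
    ; Adj    = LeviAdj
    ; sym    = λ { (point-block p) → block-point p ; (block-point p) → point-block p }
    ; irrefl = λ { refl () }
    }

  -- The inclusion X ⊆ Y is given by an injection ι.
  record IsStrongNesting {Y : Set} (ι : Point ↣ Y) (φ : Block → Y) : Set where
    open Injection ι using (to)
    field
      avoids   : ∀ A {x} → x ∈ ⟦ A ⟧ → φ A ≢ to x
      distinct : ∀ {x A y B} → x ∈ ⟦ A ⟧ → y ∈ ⟦ B ⟧ →
                 (x , A) ≢ (y , B) →
                 ¬ SamePair (to x) (φ A) (to y) (φ B)

  -- A strong nesting into some Y ⊇ X with |Y| = w.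
  StrongNesting : ℕ → Set₁
  StrongNesting w =
    Σ[ Y ∈ Set ] (Y ↔ Fin w) ×
    (Σ[ ι ∈ (Point ↣ Y) ] Σ[ φ ∈ (Block → Y) ] IsStrongNesting ι φ)

{-# OPTIONS --safe #-}
-- A harmonious colouring is injective on points: since λ > 0, two points lie in
-- a common block, whose edges to them would otherwise get the same colour pair.
-- So the colours of the points embed X into the set Y of colours, and the colour
-- of a block is its nested point.  Conversely the inclusion and φ together colour
-- the Levi graph.
module Submission where

open import Data.Nat using (ℕ; _>_)
open import Data.Fin using (Fin)
open import Data.Fin.Properties using (_≟_)
open import Data.Fin.Subset using (_∈_)
open import Data.Fin.Subset.Properties using (_∈?_)
open import Data.List using (List; _∷_; filter; lookup; length)
open import Data.List.Membership.Propositional using () renaming (_∈_ to _∈ˡ_)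
open import Data.List.Membership.Propositional.Properties using (∈-filter⁻)
open import Data.List.Relation.Unary.Any using (here; index)
open import Data.List.Relation.Unary.Any.Properties using (lookup-index)
open import Data.Product using (∃; _×_; _,_; swap)
import Data.Product as Product
open import Data.Sum using (_⊎_; inj₁; inj₂; [_,_]′)
import Data.Sum as Sum
open import Function using (_∘_)
open import Function.Bundles using (_⇔_; mk⇔; mk↣; Injection)
open import Function.Construct.Identity using (↔-id)
open import Function.Definitions using (Injective)
open import Function.Properties.Inverse using (↔⇒↣)
open import Relation.Binary.PropositionalEquality using (_≡_; _≢_; refl; sym; subst)
open import Relation.Nullary using (¬_; yes; no; contradiction)
open import Relation.Nullary.Decidable using (_×-dec_)
open import Relation.Unary using (Pred; Decidable)
open import Level using (0ℓ)
open import Defs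

-- `balanced` counts blocks by filtering the list, whereas a `Block` is a position in it. This turns
-- a positive count into such a position.
filter-nonempty⇒∃ : ∀ {A : Set} {P : Pred A 0ℓ} (P? : Decidable P) (xs : List A) →
  length (filter P? xs) > 0 → ∃ λ i → P (lookup xs i)
filter-nonempty⇒∃ {P = P} P? xs nonempty with filter P? xs in eq
... | y ∷ _ with ∈-filter⁻ P? {xs = xs} (subst (y ∈ˡ_) (sym eq) (here refl))
...   | y∈xs , Py = index y∈xs , subst P (lookup-index y∈xs) Py

SamePair-swapʳ : ∀ {A : Set} {a b c d : A} → SamePair a b c d → SamePair a b d c
SamePair-swapʳ = Sum.swap

SamePair-swapˡ : ∀ {A : Set} {a b c d : A} → SamePair a b c d → SamePair b a c d
SamePair-swapˡ = Sum.swap ∘ Sum.map swap swap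

SamePair-injective : ∀ {A B : Set} {f : A → B} → Injective _≡_ _≡_ f → ∀ {a b c d} →
  SamePair (f a) (f b) (f c) (f d) → SamePair a b c d
SamePair-injective inj = Sum.map (Product.map inj inj) (Product.map inj inj)

module _ {v k index : ℕ} (D : BIBD v k index) where
  open BIBD D

  commonBlock : ∀ {x y} → x ≢ y → ∃ λ A → x ∈ ⟦ A ⟧ × y ∈ ⟦ A ⟧
  commonBlock {x} {y} x≢y =
    filter-nonempty⇒∃ (λ S → (x ∈? S) ×-dec (y ∈? S)) blocks
      (subst (_> 0) (sym (balanced x y x≢y)) index>0)

  module _ {C : Set} {c : Point ⊎ Block → C} (harmonious : IsHarmonious (leviGraph D) c) where
    open IsHarmonious harmonious

    pointColours-injective : Injective _≡_ _≡_ (c ∘ inj₁)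
    pointColours-injective {x} {y} cx≡cy with x ≟ y
    ... | yes x≡y = x≡y
    ... | no  x≢y with commonBlock x≢y
    ...   | A , x∈A , y∈A = contradiction (inj₁ (cx≡cy , refl))
      (distinct (point-block x∈A) (point-block y∈A)
        -- The two edges share their block end, so they coincide only if `x` is `y`; a crosswise
        -- match would identify a point with a block.
        λ { (inj₁ (refl , _)) → x≢y refl ; (inj₂ (() , _)) })

    harmonious⇒nesting : IsStrongNesting D (mk↣ pointColours-injective) (c ∘ inj₂)
    harmonious⇒nesting = record
      { avoids   = λ A x∈A → proper (block-point x∈A)
      ; distinct = λ x∈A y∈B xA≢yB → distinct (point-block x∈A) (point-block y∈B)
          λ { (inj₁ (refl , refl)) → xA≢yB refl ; (inj₂ (() , _)) }
      }

  -- A nesting takes values in an arbitrary `Y`, while colours come from a fixed set, so the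
  -- colouring passes through `f`. Injectivity of `f` pulls each coincidence of colours back to `Y`.
  nesting⇒harmonious : ∀ {Y C : Set} {ι φ} {f : Y → C} → Injective _≡_ _≡_ f →
    IsStrongNesting D ι φ → IsHarmonious (leviGraph D) (f ∘ [ Injection.to ι , φ ]′)
  nesting⇒harmonious {ι = ι} {φ} {f} f-injective nesting = record
    { proper   = λ { (point-block p) e → avoids _ p (sym (f-injective e))
                   ; (block-point p) e → avoids _ p (f-injective e) }
    ; distinct = λ e e′ e≢e′ → distinct′ e e′ e≢e′ ∘ SamePair-injective f-injective
    }
    where
    open IsStrongNesting nesting
    c = [ Injection.to ι , φ ]′

    -- An edge can be presented from either end, but a nesting speaks only of pairs with the point
    -- first. Swapping the colours of each edge presented from its block reduces all four cases to
    -- that one.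
    distinct′ : ∀ {u u′ z z′} → LeviAdj D u u′ → LeviAdj D z z′ →
      ¬ SamePair u u′ z z′ → ¬ SamePair (c u) (c u′) (c z) (c z′)
    distinct′ (point-block p) (point-block q) e≢e′ =
      distinct p q λ { refl → e≢e′ (inj₁ (refl , refl)) }
    -- With opposite presentations, equal incidences give the same edge crosswise, hence `inj₂`.
    distinct′ (point-block p) (block-point q) e≢e′ =
      distinct p q (λ { refl → e≢e′ (inj₂ (refl , refl)) }) ∘ SamePair-swapʳ
    distinct′ (block-point p) (point-block q) e≢e′ =
      distinct p q (λ { refl → e≢e′ (inj₂ (refl , refl)) }) ∘ SamePair-swapˡ
    distinct′ (block-point p) (block-point q) e≢e′ =
      distinct p q (λ { refl → e≢e′ (inj₁ (refl , refl)) }) ∘ SamePair-swapˡ ∘ SamePair-swapʳ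

theorem5p1 : ∀ {v k index : ℕ} (D : BIBD v k index) (w : ℕ) →
    HarmoniousColouring (leviGraph D) w ⇔ StrongNesting D w
theorem5p1 D w = mk⇔
  -- `Y` is the whole palette rather than the set of colours that occur, so it has exactly `w`
  -- elements.
  (λ (_ , h) → Fin w , ↔-id (Fin w) , _ , _ , harmonious⇒nesting D h)
  (λ (_ , Y↔Fin , _ , _ , nesting) →
    _ , nesting⇒harmonious D (Injection.injective (↔⇒↣ Y↔Fin)) nesting)
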